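{- For any graph $G$ of order $n$ (with $n\ge 1$), \[ \operatorname{st}_{\gamma_{st}}(G)\le n-\gamma_{st}(G)+1 . \]
   Context: All graphs are finite, simple and undirected. For a graph $G=(V,E)$, a set $D\subseteq V$ is a strong dominating set if every vertex $v\in V\setminus D$ is adjacent to some $u\in D$ with $\deg(v)\le\deg(u)$ (degrees taken in $G$). The strong domination number $\gamma_{st}(G)$ is the minimum size of a strong dominating set; the graph with no vertices has $\gamma_{st}=0$. For $S\subseteq V$, $G-S$ is the graph obtained by deleting the vertices of $S$. The stability of the strong domination number is $\operatorname{st}_{\gamma_{st}}(G)=\min\{|S| : S\subseteq V,\ \gamma_{st}(G-S)\ne\gamma_{st}(G)\}$ (the choice $S=V$ is allowed, so that $\operatorname{st}_{\gamma_{st}}(K_n)=n$). -}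

module Defs where

open import Data.Fin.Base using (Fin; zero; suc)
open import Data.Fin.Properties using (all?; any?)
open import Data.Fin.Subset using (Subset; inside; outside; _∈_; _∉_; ∣_∣; ⊤; ∁; _-_)
open import Data.Fin.Subset.Properties
  using (_∈?_; anySubset?; ∈⊤; ∣⊤∣≡n; ∣∁p∣≡n∸∣p∣; x∈p⇒∣p-x∣<∣p∣)
open import Data.Nat.Base using (ℕ; zero; suc; _≤_; _<_; _∸_; NonZero)
open import Data.Nat.Induction using (Acc; acc; <-wellFounded)
open import Data.Nat.Properties
  using (_≤?_; _<?_; _≟_; ≮⇒≥; n∸n≡0; n≤0⇒n≡0; n≮0; module ≤-Reasoning)
open import Data.Product.Base using (∃; _×_; _,_; proj₁; proj₂)
open import Data.Vec.Base using (_∷_; tabulate)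
open import Function.Base using (_on_)
open import Level using (0ℓ)
open import Relation.Binary.Core using (Rel)
open import Relation.Binary.Definitions using (Decidable; Irreflexive; Symmetric)
open import Relation.Binary.PropositionalEquality
  using (_≡_; _≢_; refl; sym; trans; cong; subst)
open import Relation.Nullary.Decidable
  using (yes; no; does; ¬?; _×-dec_; _→-dec_)
open import Relation.Unary using (Pred) renaming (Decidable to Decidable₁)

-- Simple graphs of order n, with vertex set Fin n.
record Graph (n : ℕ) : Set₁ where
  field
    Adj        : Rel (Fin n) 0ℓ
    adj?       : Decidable Adj
    adj-sym    : Symmetric Adj
    adj-irrefl : Irreflexive _≡_ Adj

  neighbours : Fin n → Subset n
  neighbours v = tabulate (λ u → does (adj? v u))

  deg : Fin n → ℕ
  deg v = ∣ neighbours v ∣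

open Graph

-- The increasing enumeration of the elements of p.
element : ∀ {n} (p : Subset n) → Fin ∣ p ∣ → Fin n
element (inside  ∷ p) zero    = zero
element (inside  ∷ p) (suc i) = suc (element p i)
element (outside ∷ p) i       = suc (element p i)

-- The graph induced on the complement of S, its vertices renumbered in
-- increasing order so that it is again a graph on an initial segment.
infixl 6 _−_
_−_ : ∀ {n} → Graph n → (S : Subset n) → Graph ∣ ∁ S ∣
G − S = record
  { Adj        = Adj G on element (∁ S)
  ; adj?       = λ i j → adj? G (element (∁ S) i) (element (∁ S) j)
  ; adj-sym    = adj-sym G
  ; adj-irrefl = λ i≡j → adj-irrefl G (cong (element (∁ S)) i≡j)
  }

IsMinSize : ∀ {n} → Pred (Subset n) 0ℓ → ℕ → Set
IsMinSize P k = (∃ λ S → P S × ∣ S ∣ ≡ k) × (∀ S → P S → k ≤ ∣ S ∣)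

minSize : ∀ {n} {P : Pred (Subset n) 0ℓ} →
          Decidable₁ P → ∃ P → ∃ (IsMinSize P)
minSize {P = P} P? (S₀ , p₀) = descend S₀ p₀ (<-wellFounded ∣ S₀ ∣)
  where
  descend : ∀ S → P S → Acc _<_ ∣ S ∣ → ∃ (IsMinSize P)
  descend S p (acc rec) with anySubset? (λ T → P? T ×-dec (∣ T ∣ <? ∣ S ∣))
  ... | yes (T , q , T<S) = descend T q (rec T<S)
  ... | no  none          =
    ∣ S ∣ , (S , p , refl) , λ T q → ≮⇒≥ (λ T<S → none (T , q , T<S))

StrongDominating : ∀ {n} → Graph n → Pred (Subset n) 0ℓ
StrongDominating G D =
  ∀ v → v ∉ D → ∃ λ u → u ∈ D × Adj G v u × deg G v ≤ deg G u

strongDominating? : ∀ {n} (G : Graph n) → Decidable₁ (StrongDominating G)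
strongDominating? G D =
  all? λ v → ¬? (v ∈? D) →-dec
    any? λ u → (u ∈? D) ×-dec adj? G v u ×-dec (deg G v ≤? deg G u)

⊤-strongDominating : ∀ {n} (G : Graph n) → StrongDominating G ⊤
⊤-strongDominating G v v∉⊤ with () ← v∉⊤ ∈⊤

γst-spec : ∀ {n} (G : Graph n) → ∃ (IsMinSize (StrongDominating G))
γst-spec G = minSize (strongDominating? G) (⊤ , ⊤-strongDominating G)

γst : ∀ {n} → Graph n → ℕ
γst G = proj₁ (γst-spec G)

-- In particular n ∸ γst G is never truncated.
γst≤order : ∀ {n} (G : Graph n) → γst G ≤ n
γst≤order {n} G =
  subst (γst G ≤_) (∣⊤∣≡n n) (proj₂ (proj₂ (γst-spec G)) ⊤ (⊤-strongDominating G))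

∣p∣≡0⇒x∉p : ∀ {n} {p : Subset n} {x : Fin n} → ∣ p ∣ ≡ 0 → x ∉ p
∣p∣≡0⇒x∉p {p = p} {x} ∣p∣≡0 x∈p =
  n≮0 (subst (∣ p - x ∣ <_) ∣p∣≡0 (x∈p⇒∣p-x∣<∣p∣ x∈p))

γst≢0 : ∀ {n} .{{_ : NonZero n}} (G : Graph n) → γst G ≢ 0
γst≢0 {suc n} G γ≡0 =
  let (_ , (D , dom , ∣D∣≡γ) , _) = γst-spec G
      ∣D∣≡0         = trans ∣D∣≡γ γ≡0
      (_ , u∈D , _) = dom zero (∣p∣≡0⇒x∉p ∣D∣≡0)
  in ∣p∣≡0⇒x∉p ∣D∣≡0 u∈D

Changesγst : ∀ {n} → Graph n → Pred (Subset n) 0ℓ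
Changesγst G S = γst (G − S) ≢ γst G

⊤-changes : ∀ {n} .{{_ : NonZero n}} (G : Graph n) → Changesγst G ⊤
⊤-changes {n} G eq = γst≢0 G (trans (sym eq) (n≤0⇒n≡0 γ≤0))
  where
  open ≤-Reasoning
  γ≤0 : γst (G − ⊤) ≤ 0
  γ≤0 = begin
    γst (G − ⊤)      ≤⟨ γst≤order (G − ⊤) ⟩
    ∣ ∁ (⊤ {n}) ∣    ≡⟨ ∣∁p∣≡n∸∣p∣ (⊤ {n}) ⟩
    n ∸ ∣ ⊤ {n} ∣    ≡⟨ cong (n ∸_) (∣⊤∣≡n n) ⟩
    n ∸ n            ≡⟨ n∸n≡0 n ⟩
    0                ∎

-- No set of vertices changes γst of the graph of order 0, so its stability is
-- undefined; this is why n is required to be nonzero.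
stγst-spec : ∀ {n} .{{_ : NonZero n}} (G : Graph n) → ∃ (IsMinSize (Changesγst G))
stγst-spec G =
  minSize (λ S → ¬? (γst (G − S) ≟ γst G)) (⊤ , ⊤-changes G)

stγst : ∀ {n} .{{_ : NonZero n}} → Graph n → ℕ
stγst G = proj₁ (stγst-spec G)

{-# OPTIONS --safe #-}
module Submission where

open import Defs
open import Data.Fin.Subset using (Subset; inside; outside; Nonempty; _∈_; _∪_; ∣_∣; ∁; ⁅_⁆)
open import Data.Fin.Subset.Properties
  using (nonempty?; Empty-unique; ∣⊥∣≡0; x∈⁅x⁆; ∣⁅x⁆∣≡1; ∣∁p∣≡n∸∣p∣; x∈p⇒x∉∁p; x∈∁p⇒x∉p;
         x∉∁p⇒x∈p; p⊆p∪q; q⊆p∪q; p⊂q⇒∣p∣<∣q∣)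
open import Data.Nat.Base using (ℕ; _+_; _∸_; _≤_; _<_; z≤n; s≤s; NonZero)
open import Data.Nat.Properties using (≤-<-trans; <⇒≢; ≤-trans; +-monoʳ-≤; n≤1+n; +-suc; module ≤-Reasoning)
open import Data.Product.Base using (_,_; proj₂)
open import Data.Vec.Base using ([]; _∷_)
open import Function.Base using (_∘_)
open import Relation.Binary.PropositionalEquality using (_≢_; sym; trans; cong; cong₂; subst)
open import Relation.Nullary.Decidable using (yes; no)
open import Relation.Nullary.Negation using (contradiction)

-- Deleting all but γst G − 1 vertices leaves a graph whose order, and hence
-- whose strong domination number, is less than γst G.  The surviving vertices
-- are those of a minimum strong dominating set with one element removed.

∣p∣≢0⇒Nonempty : ∀ {n} (p : Subset n) → ∣ p ∣ ≢ 0 → Nonempty p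
∣p∣≢0⇒Nonempty {n} p ∣p∣≢0 with nonempty? p
... | yes ne   = ne
... | no empty = contradiction (trans (cong ∣_∣ (Empty-unique empty)) (∣⊥∣≡0 n)) ∣p∣≢0

-- The set on the left is `p` without `x`, a proper subset of `p` with `x` as the witness of
-- strictness.
x∈p⇒∣∁[∁p∪⁅x⁆]∣<∣p∣ : ∀ {n} (p : Subset n) {x} → x ∈ p → ∣ ∁ (∁ p ∪ ⁅ x ⁆) ∣ < ∣ p ∣
x∈p⇒∣∁[∁p∪⁅x⁆]∣<∣p∣ p {x} x∈p = p⊂q⇒∣p∣<∣q∣
  ( (λ y∈ → x∉∁p⇒x∈p (x∈∁p⇒x∉p y∈ ∘ p⊆p∪q ⁅ x ⁆))
  , x , x∈p , x∈p⇒x∉∁p (q⊆p∪q (∁ p) ⁅ x ⁆ (x∈⁅x⁆ x)))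

∣p∪q∣≤∣p∣+∣q∣ : ∀ {n} (p q : Subset n) → ∣ p ∪ q ∣ ≤ ∣ p ∣ + ∣ q ∣
∣p∪q∣≤∣p∣+∣q∣ []            []            = z≤n
∣p∪q∣≤∣p∣+∣q∣ (inside  ∷ p) (inside  ∷ q) =
  -- A shared element counts once on the left and twice on the right; `n≤1+n` absorbs the surplus.
  s≤s (≤-trans (∣p∪q∣≤∣p∣+∣q∣ p q) (+-monoʳ-≤ ∣ p ∣ (n≤1+n ∣ q ∣)))
∣p∪q∣≤∣p∣+∣q∣ (inside  ∷ p) (outside ∷ q) = s≤s (∣p∪q∣≤∣p∣+∣q∣ p q)
∣p∪q∣≤∣p∣+∣q∣ (outside ∷ p) (inside  ∷ q) rewrite +-suc ∣ p ∣ ∣ q ∣ = s≤s (∣p∪q∣≤∣p∣+∣q∣ p q)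
∣p∪q∣≤∣p∣+∣q∣ (outside ∷ p) (outside ∷ q) = ∣p∪q∣≤∣p∣+∣q∣ p q

-- Subadditivity gives this for every `x`; for `x ∈ p` the union is disjoint and equality holds.
∣∁p∪⁅x⁆∣≤n∸∣p∣+1 : ∀ {n} (p : Subset n) x → ∣ ∁ p ∪ ⁅ x ⁆ ∣ ≤ n ∸ ∣ p ∣ + 1
∣∁p∪⁅x⁆∣≤n∸∣p∣+1 {n} p x = begin
  ∣ ∁ p ∪ ⁅ x ⁆ ∣          ≤⟨ ∣p∪q∣≤∣p∣+∣q∣ (∁ p) ⁅ x ⁆ ⟩
  ∣ ∁ p ∣ + ∣ ⁅ x ⁆ ∣      ≡⟨ cong₂ _+_ (∣∁p∣≡n∸∣p∣ p) (∣⁅x⁆∣≡1 x) ⟩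
  n ∸ ∣ p ∣ + 1            ∎
  where open ≤-Reasoning

-- The whole vertex set of `G − S` is strong dominating, so `∣ ∁ S ∣` bounds `γst (G − S)` from
-- above.
order<γst⇒changes : ∀ {n} (G : Graph n) S → ∣ ∁ S ∣ < γst G → Changesγst G S
order<γst⇒changes G S ∣∁S∣<γ = <⇒≢ (≤-<-trans (γst≤order (G − S)) ∣∁S∣<γ)

theorem3p1 : ∀ (n : ℕ) .{{_ : NonZero n}} (G : Graph n) →
    stγst G ≤ n ∸ γst G + 1
theorem3p1 n G =
  let (_ , (D , _ , ∣D∣≡γ) , _) = γst-spec G
      -- A vertex to remove from `D` exists because a graph of nonzero order has `γst G ≢ 0`.
      (x , x∈D) = ∣p∣≢0⇒Nonempty D (subst (_≢ 0) (sym ∣D∣≡γ) (γst≢0 G))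
      -- `S` is the deleted set: everything outside `D`, and `x` to bring the remaining order below
      -- `γst G`.
      S         = ∁ D ∪ ⁅ x ⁆
      changes   = order<γst⇒changes G S (subst (∣ ∁ S ∣ <_) ∣D∣≡γ (x∈p⇒∣∁[∁p∪⁅x⁆]∣<∣p∣ D x∈D))
  in begin
    stγst G          ≤⟨ proj₂ (proj₂ (stγst-spec G)) S changes ⟩
    ∣ S ∣            ≤⟨ ∣∁p∪⁅x⁆∣≤n∸∣p∣+1 D x ⟩
    n ∸ ∣ D ∣ + 1    ≡⟨ cong (λ k → n ∸ k + 1) ∣D∣≡γ ⟩
    n ∸ γst G + 1    ∎
  where open ≤-Reasoning
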